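{- Let $0<s<2m$ with $s\neq m$, let $t$ be a legitimate quadruple, and let $l=0$ or $l\in L^*\setminus(L^*)^{\sigma-1}$. Then $B(2,m,s,l,t)$ is not isotopic to a commutative semifield.
   Context: A (finite) presemifield is a finite additive abelian group with a multiplication that is distributive on both sides over addition and has no zero divisors; it is a semifield if it also has a multiplicative identity, and commutative if its multiplication is commutative. Two presemifields $(F,+,*)$ and $(F,+,\circ)$ are isotopic if there are additive bijections $\alpha_1,\alpha_2,\beta$ with $\beta(\alpha_1(x)*\alpha_2(y))=x\circ y$ for all $x,y$. Let $m\ge 1$, $L=GF(2^m)$, $\sigma=2^s$, $(L^*)^{\sigma-1}=\{u^{\sigma-1}:u\in L^*\}$. A quadruple $t=[p_1,p_2,p_3,p_4]\in L^4$ is legitimate if $p_1\neq0$ and $p_1X^{\sigma+1}+p_2X^{\sigma}+p_3X+p_4$ has no root in $L$. $B(2,m,s,l,t)$ is the presemifield on $L\times L$ with multiplication $$(a,b)\circ(c,d)=(p_1ac^{\sigma}+lp_1a^{\sigma}c+p_2bc^{\sigma}+lp_2a^{\sigma}d+p_3ad^{\sigma}+lp_3b^{\sigma}c+p_4bd^{\sigma}+lp_4b^{\sigma}d,\ ad+bc).$$ -}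

module Defs where

open import Algebra.Bundles using (AbelianGroup; CommutativeRing)
open import Algebra.Bundles.Raw using (RawNearSemiring)
open import Algebra.Core using (Op₂)
open import Algebra.Definitions using (Congruent₂; _DistributesOver_; Identity; Commutative; Invertible)
open import Algebra.Morphism.Structures using (module MagmaMorphisms)
open import Data.Fin.Base using (Fin)
open import Data.Nat.Base as ℕ using (ℕ)
open import Data.Product.Base using (_×_; _,_; ∃; zip)
open import Data.Product.Relation.Binary.Pointwise.NonDependent using (Pointwise)
open import Data.Sum.Base using (_⊎_)
open import Function.Bundles using (Inverse)
open import Level using (Level; _⊔_; suc)
open import Relation.Binary.Bundles using (Setoid)
open import Relation.Binary.PropositionalEquality.Properties using () renaming (setoid to ≡-setoid)
open import Relation.Nullary.Negation using (¬_)
open import Relation.Unary using (Pred; _∉_)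
import Algebra.Properties.Semiring.Exp as Exp

HasCardinality : ∀ {c ℓ} → Setoid c ℓ → ℕ → Set (c ⊔ ℓ)
HasCardinality S n = Inverse S (≡-setoid (Fin n))

-- Discrete fields, in which "nonzero" means ¬ (x ≈ 0#): unlike the library's
-- HeytingField, no apartness relation is part of the data.  GF(q) is rendered
-- as any field of cardinality q.
record Field c ℓ : Set (suc (c ⊔ ℓ)) where
  field
    commutativeRing : CommutativeRing c ℓ
  open CommutativeRing commutativeRing public
  field
    1≉0     : 1# ≉ 0#
    inverse : ∀ {x} → x ≉ 0# → Invertible _≈_ 1# _*_ x

record Presemifield c ℓ : Set (suc (c ⊔ ℓ)) where
  infixl 7 _*_
  field
    +-abelianGroup : AbelianGroup c ℓ
  open AbelianGroup +-abelianGroup public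
    using (Carrier; _≈_; _≉_; setoid)
    renaming (_∙_ to _+_; ε to 0#; _⁻¹ to -_)
  field
    _*_            : Op₂ Carrier
    *-cong         : Congruent₂ _≈_ _*_
    distrib        : _DistributesOver_ _≈_ _*_ _+_
    noZeroDivisors : ∀ {x y} → x * y ≈ 0# → x ≈ 0# ⊎ y ≈ 0#
    finite         : ∃ (HasCardinality setoid)

  rawNearSemiring : RawNearSemiring c ℓ
  rawNearSemiring = record
    { Carrier = Carrier ; _≈_ = _≈_ ; _+_ = _+_ ; _*_ = _*_ ; 0# = 0# }

record Semifield c ℓ : Set (suc (c ⊔ ℓ)) where
  field
    presemifield : Presemifield c ℓ
  open Presemifield presemifield public
  field
    1#         : Carrier
    *-identity : Identity _≈_ 1# _*_

record CommutativeSemifield c ℓ : Set (suc (c ⊔ ℓ)) where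
  field
    semifield : Semifield c ℓ
  open Semifield semifield public
  field
    *-comm : Commutative _≈_ _*_

-- Only the addition and multiplication of the two structures enter the notion
-- of isotopism, so, as for the library's morphisms, it is stated on raw bundles.
-- The additive groups need not be literally the same group: α₁, α₂ go from the
-- second structure to the first and β goes back.
record Isotopic {a ℓ₁ b ℓ₂} (F : RawNearSemiring a ℓ₁) (G : RawNearSemiring b ℓ₂)
              : Set (a ⊔ ℓ₁ ⊔ b ⊔ ℓ₂) where
  private
    module F = RawNearSemiring F
    module G = RawNearSemiring G
    module G→F = MagmaMorphisms G.+-rawMagma F.+-rawMagma
    module F→G = MagmaMorphisms F.+-rawMagma G.+-rawMagma
  field
    α₁ α₂     : G.Carrier → F.Carrier
    β         : F.Carrier → G.Carrier
    α₁-iso    : G→F.IsMagmaIsomorphism α₁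
    α₂-iso    : G→F.IsMagmaIsomorphism α₂
    β-iso     : F→G.IsMagmaIsomorphism β
    isotopism : ∀ x y → β (α₁ x F.* α₂ y) G.≈ x G.* y

module _ {c ℓ} (L : Field c ℓ) where
  open Field L
  open Exp semiring using (_^_)

  Quadruple : Set c
  Quadruple = Carrier × Carrier × Carrier × Carrier

  -- (L*)^k
  UnitPowers : ℕ → Pred Carrier (c ⊔ ℓ)
  UnitPowers k x = ∃ λ u → u ≉ 0# × x ≈ u ^ k

  module _ (s : ℕ) where

    private
      σ : ℕ
      σ = 2 ℕ.^ s

    Legitimate : Quadruple → Set (c ⊔ ℓ)
    Legitimate (p₁ , p₂ , p₃ , p₄) =
      p₁ ≉ 0# ×
      ¬ (∃ λ x → p₁ * x ^ (σ ℕ.+ 1) + p₂ * x ^ σ + p₃ * x + p₄ ≈ 0#)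

    Admissible : Pred Carrier (c ⊔ ℓ)
    Admissible l = l ≈ 0# ⊎ (l ≉ 0# × l ∉ UnitPowers (σ ℕ.∸ 1))

    module _ (l : Carrier) where

      B-mul : Quadruple → Op₂ (Carrier × Carrier)
      B-mul (p₁ , p₂ , p₃ , p₄) (a , b) (c , d) =
        ( p₁ * a * c ^ σ + l * p₁ * a ^ σ * c
        + p₂ * b * c ^ σ + l * p₂ * a ^ σ * d
        + p₃ * a * d ^ σ + l * p₃ * b ^ σ * c
        + p₄ * b * d ^ σ + l * p₄ * b ^ σ * d
        ) , a * d + b * c

      B : Quadruple → RawNearSemiring c ℓ
      B t = record
        { Carrier = Carrier × Carrier
        ; _≈_     = Pointwise _≈_ _≈_
        ; _+_     = zip _+_ _+_
        ; _*_     = B-mul t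
        ; 0#      = 0# , 0#
        }

{-# OPTIONS --safe #-}
module Submission where

-- An isotopism to a commutative semifield makes T = α₂ ∘ α₁⁻¹ satisfy x ∘ T y = y ∘ T x.  The second
-- component of this identity forces T (a , b) = (r a + n b , k a + r b).  With M = [[p₁,p₃],[p₂,p₄]]
-- and N = [[r,n],[k,r]], the first component then reads M N^σ = l Nᵗ M, because x ↦ x^σ is not the
-- identity.  Legitimacy gives det M ≠ 0 and bijectivity of T gives det N ≠ 0, so comparing
-- determinants (det N)^σ = l² det N.  Taking square roots, u^σ = l u for u ≠ 0 with u² = det N,
-- which contradicts l = 0 as well as l ∉ (L*)^(σ-1).

open import Defs
open import Algebra.Bundles using (CommutativeMonoid; CommutativeRing)
open import Algebra.Core using (Op₂)
open import Algebra.Morphism.Structures using (module MagmaMorphisms)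
import Algebra.Properties.CommutativeMonoid.Sum as Sum
import Algebra.Properties.CommutativeSemiring.Exp as Exp
import Algebra.Properties.Group as GroupProperties
import Algebra.Properties.Ring as RingProperties
import Algebra.Properties.Semiring.Mult as Mult
import Algebra.Solver.Ring as RingSolver
open import Algebra.Solver.Ring.AlmostCommutativeRing
  using (AlmostCommutativeRing; fromCommutativeSemiring; _-Raw-AlmostCommutative⟶_)
open import Data.Bool.Base using (Bool; true; false; if_then_else_)
open import Data.Bool.Properties using (xor-∧-commutativeRing) renaming (_≟_ to _≟ᵇ_)
open import Data.Empty using (⊥; ⊥-elim)
open import Data.Fin.Base as Fin using (Fin; zero; suc; inject≤; punchIn)
open import Data.Fin.Permutation using (Permutation; _⟨$⟩ʳ_)
import Data.Fin.Properties as Fin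
open import Data.Maybe.Base as Maybe using (Maybe)
open import Data.Nat.Base as ℕ using (ℕ; zero; suc; _≤_; _<_)
import Data.Nat.Properties as ℕ
open import Data.Product.Base using (_×_; _,_; ∃; proj₁; proj₂)
open import Data.Product.Relation.Binary.Pointwise.NonDependent using (Pointwise; ×-setoid)
open import Data.Sum.Base using (inj₁; inj₂)
open import Data.Vec.Base using (Vec; []; _∷_; replicate)
open import Function.Base using (_∘_; id)
open import Function.Bundles using (Inverse)
open import Function.Construct.Composition using () renaming (inverse to _⨾_)
open import Function.Construct.Symmetry using () renaming (inverse to _⁻¹)
open import Function.Definitions using (Injective)
open import Relation.Binary.Bundles using (Setoid)
open import Relation.Binary.Definitions using (Decidable; tri<; tri≈; tri>)
open import Relation.Binary.PropositionalEquality as ≡ using (_≡_; _≢_)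
import Relation.Binary.Reasoning.Setoid as ≈-Reasoning
open import Relation.Nullary.Decidable using (yes; no; map′; does; dec⇒maybe; decidable-stable)
open import Relation.Nullary.Negation using (¬_)

-- Cancellation and nonvanishing of products in a field.

module FieldProperties {c ℓ} (L : Field c ℓ) where
  open Field L hiding (zero)
  open Exp commutativeSemiring using (_^_)
  open RingProperties ring using (x[y-z]≈xy-xz)
  open GroupProperties +-group using (x∙y⁻¹≈ε⇒x≈y; x≈y⇒x∙y⁻¹≈ε)
  open ≈-Reasoning setoid

  x*y≈0⇒y≈0 : ∀ {x y} → x ≉ 0# → x * y ≈ 0# → y ≈ 0#
  x*y≈0⇒y≈0 {x} {y} x≉0 xy≈0 = let (x⁻¹ , x⁻¹x≈1 , _) = inverse x≉0 in begin
    y              ≈⟨ *-identityˡ y ⟨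
    1# * y         ≈⟨ *-congʳ x⁻¹x≈1 ⟨
    x⁻¹ * x * y    ≈⟨ *-assoc _ _ _ ⟩
    x⁻¹ * (x * y)  ≈⟨ *-congˡ xy≈0 ⟩
    x⁻¹ * 0#       ≈⟨ zeroʳ _ ⟩
    0#             ∎

  *-cancelˡ : ∀ {x y z} → x ≉ 0# → x * y ≈ x * z → y ≈ z
  *-cancelˡ x≉0 xy≈xz = x∙y⁻¹≈ε⇒x≈y _ _ (x*y≈0⇒y≈0 x≉0
    (trans (x[y-z]≈xy-xz _ _ _) (x≈y⇒x∙y⁻¹≈ε xy≈xz)))

  x*y≉0 : ∀ {x y} → x ≉ 0# → y ≉ 0# → x * y ≉ 0#
  x*y≉0 x≉0 y≉0 = y≉0 ∘ x*y≈0⇒y≈0 x≉0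

  x^n≉0 : ∀ {x} n → x ≉ 0# → x ^ n ≉ 0#
  x^n≉0 zero    x≉0 = 1≉0
  x^n≉0 (suc n) x≉0 = x*y≉0 x≉0 (x^n≉0 n x≉0)

-- Finite fields: `q · 1# ≈ 0#` and `x ^ q ≈ x`, by summing and multiplying over all elements.

module FiniteField {c ℓ} (L : Field c ℓ) {q} (card : HasCardinality (Field.setoid L) q) where
  open Field L hiding (zero)
  open FieldProperties L
  open Exp commutativeSemiring using (_^_; ^-congˡ)
  open Mult semiring using () renaming (_×_ to _·_)
  open GroupProperties +-group using (identityʳ-unique)
  module +-Group = GroupProperties +-group
  open Inverse card public using (strictlyInverseʳ) renaming (to to index; to-cong to index-cong; from to element)
  open ≈-Reasoning setoid

  infix 4 _≟_
  abstract
    _≟_ : Decidable _≈_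
    x ≟ y = map′
      (λ i≡j → trans (sym (strictlyInverseʳ x)) (trans (reflexive (≡.cong element i≡j)) (strictlyInverseʳ y)))
      index-cong (index x Fin.≟ index y)

  element-injective : Injective _≡_ _≈_ element
  element-injective {i} {j} eq = ≡.trans (≡.sym (Inverse.strictlyInverseˡ card i))
    (≡.trans (index-cong eq) (Inverse.strictlyInverseˡ card j))

  -- A search through the enumeration makes the failure constructive; this later yields an actual
  -- element moved by the Frobenius map.
  ∃-counterexample : (f : Carrier → Carrier) → (∀ {x y} → x ≈ y → f x ≈ f y) →
                     ¬ (∀ x → f x ≈ x) → ∃ λ x → f x ≉ x
  ∃-counterexample f f-cong ¬all =
    let (i , fi≉i) = Fin.¬∀⟶∃¬ q (λ i → f (element i) ≈ element i) (λ i → f (element i) ≟ element i)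
                       (λ all → ¬all (λ x → trans (f-cong (sym (strictlyInverseʳ x)))
                         (trans (all (index x)) (strictlyInverseʳ x))))
    in element i , fi≉i

  module BigOp {a b} (M : CommutativeMonoid a b) where
    private module M = CommutativeMonoid M
    open Sum M

    ∑ : (Carrier → M.Carrier) → M.Carrier
    ∑ h = sum (h ∘ element)

    -- Conjugating `π` by the enumeration gives a permutation of `Fin q`, under which finite sums
    -- are invariant.
    ∑-reindex : (π : Inverse setoid setoid) (h : Carrier → M.Carrier) →
                (∀ {x y} → x ≈ y → h x M.≈ h y) → ∑ h M.≈ ∑ (h ∘ Inverse.to π)
    ∑-reindex π h h-cong = M.trans (sum-permute (h ∘ element) π′)
      (sum-cong-≋ {q} {h ∘ element ∘ (π′ ⟨$⟩ʳ_)} {h ∘ Inverse.to π ∘ element}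
        (λ i → h-cong (strictlyInverseʳ _)))
      where
      π′ : Permutation q q
      π′ = (card ⁻¹) ⨾ (π ⨾ card)

  -- The translation by `1#` permutes the field, so adding `1#` to each of the `q` summands leaves
  -- the sum of all elements unchanged.
  q·1≈0 : q · 1# ≈ 0#
  q·1≈0 = identityʳ-unique (∑ id) (q · 1#) (begin
    ∑ id + q · 1#        ≈⟨ +-congˡ (sum-replicate q) ⟨
    ∑ id + ∑ (λ _ → 1#)  ≈⟨ ∑-distrib-+ element (λ _ → 1#) ⟨
    ∑ (λ x → x + 1#)            ≈⟨ ∑-reindex shift id id ⟨
    ∑ id                 ∎)
    where
    open BigOp +-commutativeMonoid
    open Sum +-commutativeMonoid

    shift : Inverse setoid setoid
    shift = record
      { to        = _+ 1#
      ; from      = _+ - 1#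
      ; to-cong   = +-congʳ
      ; from-cong = +-congʳ
      ; inverse   = (λ eq → trans (+-congʳ eq) (+-Group.//-rightDividesˡ 1# _))
                  , (λ eq → trans (+-congʳ eq) (+-Group.//-rightDividesʳ 1# _))
      }

  module _ {a} (a≉0 : a ≉ 0#) where
    open BigOp *-commutativeMonoid renaming (∑ to ∏; ∑-reindex to ∏-reindex)
    open Sum *-commutativeMonoid renaming
      ( sum to product; sum-remove to product-remove; sum-cong-≋ to product-cong
      ; sum-replicate to product-replicate; ∑-distrib-+ to product-distrib-*)

    private
      -- The default value `1#` at zero turns a product over the whole field into one over its
      -- units, so that it can be cancelled.
      onUnits : Carrier → (Carrier → Carrier) → Carrier
      onUnits x f = if does (x ≟ 0#) then 1# else f x

      onUnits-0 : ∀ {x} f → x ≈ 0# → onUnits x f ≈ 1#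
      onUnits-0 {x} f x≈0 with x ≟ 0#
      ... | yes _  = refl
      ... | no x≉0 = ⊥-elim (x≉0 x≈0)

      onUnits-≉0 : ∀ {x} f → x ≉ 0# → onUnits x f ≈ f x
      onUnits-≉0 {x} f x≉0 with x ≟ 0#
      ... | yes x≈0 = ⊥-elim (x≉0 x≈0)
      ... | no _    = refl

      unit factor : Carrier → Carrier
      unit x = onUnits x id
      factor x = onUnits x (λ _ → a)

      unit-cong : ∀ {x y} → x ≈ y → unit x ≈ unit y
      unit-cong {x} {y} x≈y with x ≟ 0#
      ... | yes x≈0 = sym (onUnits-0 id (trans (sym x≈y) x≈0))
      ... | no x≉0  = trans x≈y (sym (onUnits-≉0 id (x≉0 ∘ trans x≈y)))

      unit-* : ∀ x → unit (a * x) ≈ factor x * unit x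
      unit-* x with x ≟ 0#
      ... | yes x≈0 = trans (onUnits-0 id (trans (*-congˡ x≈0) (zeroʳ a))) (sym (*-identityˡ 1#))
      ... | no x≉0  = onUnits-≉0 id (x*y≉0 a≉0 x≉0)

      unit≉0 : ∀ x → unit x ≉ 0#
      unit≉0 x with x ≟ 0#
      ... | yes _  = 1≉0
      ... | no x≉0 = x≉0

      product≉0 : ∀ {n} (f : Fin n → Carrier) → (∀ i → f i ≉ 0#) → product f ≉ 0#
      product≉0 {zero}  f f≉0 = 1≉0
      product≉0 {suc n} f f≉0 = x*y≉0 (f≉0 zero) (product≉0 (f ∘ suc) (f≉0 ∘ suc))

      scale : Inverse setoid setoid
      scale = let (a⁻¹ , a⁻¹a≈1 , aa⁻¹≈1) = inverse a≉0 in record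
        { to        = a *_
        ; from      = a⁻¹ *_
        ; to-cong   = *-congˡ
        ; from-cong = *-congˡ
        ; inverse   =
            (λ eq → trans (*-congˡ eq) (trans (sym (*-assoc _ _ _)) (trans (*-congʳ aa⁻¹≈1) (*-identityˡ _))))
          , (λ eq → trans (*-congˡ eq) (trans (sym (*-assoc _ _ _)) (trans (*-congʳ a⁻¹a≈1) (*-identityˡ _))))
        }

      -- Multiplication by `a` permutes the field, so the product of all units equals itself times
      -- `∏ factor`; being nonzero, it cancels.
      ∏factor≈1 : ∏ factor ≈ 1#
      ∏factor≈1 = *-cancelˡ (product≉0 (unit ∘ element) (λ i → unit≉0 (element i))) (begin
        ∏ unit * ∏ factor              ≈⟨ *-comm _ _ ⟩
        ∏ factor * ∏ unit              ≈⟨ product-distrib-* (factor ∘ element) (unit ∘ element) ⟨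
        ∏ (λ x → factor x * unit x)    ≈⟨ product-cong (λ i → unit-* (element i)) ⟨
        ∏ (λ x → unit (a * x))         ≈⟨ ∏-reindex scale unit unit-cong ⟨
        ∏ unit                         ≈⟨ *-identityʳ _ ⟨
        ∏ unit * 1#                    ∎)

      -- The extra factor `a` replaces the `1#` at position `i`, which avoids the exponent `n - 1`.
      product-allBut : ∀ {n} (i : Fin n) (f : Fin n → Carrier) → f i ≈ 1# →
                       (∀ j → j ≢ i → f j ≈ a) → a * product f ≈ a ^ n
      product-allBut {suc n} i f fi≈1 fj≈a = *-congˡ (begin
        product f                          ≈⟨ product-remove {i = i} f ⟩
        f i * product (f ∘ punchIn i)      ≈⟨ *-cong fi≈1 (product-cong {n} {f ∘ punchIn i} {λ _ → a}
                                                (λ j → fj≈a _ (Fin.punchInᵢ≢i i j))) ⟩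
        1# * product {n} (λ _ → a)         ≈⟨ *-identityˡ _ ⟩
        product {n} (λ _ → a)              ≈⟨ product-replicate n ⟩
        a ^ n                              ∎)

    a^q≈a : a ^ q ≈ a
    a^q≈a = begin
      -- The exceptional position is the index of `0#`, the only element where `factor` takes its
      -- default value.
      a ^ q         ≈⟨ product-allBut (index 0#) (factor ∘ element)
                         (onUnits-0 (λ _ → a) (strictlyInverseʳ 0#))
                         (λ j j≢i → onUnits-≉0 (λ _ → a) (λ ej≈0 → j≢i (element-injective
                           (trans ej≈0 (sym (strictlyInverseʳ 0#)))))) ⟨
      a * ∏ factor  ≈⟨ *-congˡ ∏factor≈1 ⟩
      a * 1#        ≈⟨ *-identityʳ a ⟩
      a             ∎

  0^n≈0 : ∀ {n} → 1 ≤ n → 0# ^ n ≈ 0#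
  0^n≈0 {suc n} _ = zeroˡ _

  x^q≈x : 1 ≤ q → ∀ x → x ^ q ≈ x
  x^q≈x 1≤q x with x ≟ 0#
  ... | yes x≈0 = trans (^-congˡ q x≈0) (trans (0^n≈0 1≤q) (sym x≈0))
  ... | no x≉0  = a^q≈a x≉0

-- Commutative rings of characteristic two and a ring solver for them.

CharTwo : ∀ {c ℓ} → CommutativeRing c ℓ → Set ℓ
CharTwo R = 1# + 1# ≈ 0#
  where open CommutativeRing R

module CharacteristicTwo {c ℓ} (R : CommutativeRing c ℓ) (1+1≈0 : CharTwo R) where
  open CommutativeRing R hiding (zero)

  private
    almostRing : AlmostCommutativeRing _ _
    almostRing = fromCommutativeSemiring commutativeSemiring

    ⟦_⟧ : Bool → Carrier
    ⟦ b ⟧ = if b then 1# else 0#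

    𝔽₂⟶R : CommutativeRing.rawRing xor-∧-commutativeRing -Raw-AlmostCommutative⟶ almostRing
    𝔽₂⟶R = record
      { ⟦_⟧    = ⟦_⟧
      ; +-homo = λ { false y → sym (+-identityˡ _) ; true false → sym (+-identityʳ _) ; true true → sym 1+1≈0 }
      ; *-homo = λ { false y → sym (zeroˡ _) ; true y → sym (*-identityˡ _) }
      ; -‿homo = λ _ → refl
      ; 0-homo = refl
      ; 1-homo = refl
      }

    _coeff≟_ : ∀ x y → Maybe (⟦ x ⟧ ≈ ⟦ y ⟧)
    x coeff≟ y = Maybe.map (λ { ≡.refl → refl }) (dec⇒maybe (x ≟ᵇ y))

  -- Coefficients in 𝔽₂ let the solver see x + x ≈ 0, so that no subtraction is needed.
  module Solver = RingSolver (CommutativeRing.rawRing xor-∧-commutativeRing) almostRing 𝔽₂⟶R _coeff≟_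
  open Solver

  x+y≈0⇒x≈y : ∀ {x y} → x + y ≈ 0# → x ≈ y
  x+y≈0⇒x≈y {x} {y} x+y≈0 = trans (solve 2 (λ x y → x := (x :+ y) :+ y) refl x y)
    (trans (+-congʳ x+y≈0) (+-identityˡ y))

  x≈y⇒x+y≈0 : ∀ {x y} → x ≈ y → x + y ≈ 0#
  x≈y⇒x+y≈0 {x} {y} x≈y = trans (+-congʳ x≈y) (solve 1 (λ x → x :+ x := con false) refl y)

-- Monic polynomials and the bound on the number of their roots.

module MonicPolynomial {c ℓ} (L : Field c ℓ) (1+1≈0 : CharTwo (Field.commutativeRing L)) where
  open Field L hiding (zero)
  open FieldProperties L
  open CharacteristicTwo commutativeRing 1+1≈0
  open Solver using (solve; con; _:+_; _:*_; _:=_)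
  open Exp commutativeSemiring using (_^_)
  open ≈-Reasoning setoid

  -- The coefficients are listed from the constant term upwards, the leading 1 being omitted.
  Monic : ℕ → Set c
  Monic = Vec Carrier

  eval : ∀ {d} → Monic d → Carrier → Carrier
  eval []       x = 1#
  eval (b ∷ bs) x = b + x * eval bs x

  -- Synthetic division by `X + a`: the coefficients are the intermediate values of Horner's scheme
  -- at `a`.
  quotient : ∀ {d} → Carrier → Monic (suc d) → Monic d
  quotient a (b ∷ [])            = []
  quotient a (b ∷ bs@(_ ∷ _)) = eval bs a ∷ quotient a bs

  eval-quotient : ∀ {d} a (p : Monic (suc d)) x →
                  eval p x + eval p a ≈ (x + a) * eval (quotient a p) x
  eval-quotient a (b ∷ []) x =
    solve 3 (λ a b x → (b :+ x :* con true) :+ (b :+ a :* con true) := (x :+ a) :* con true) refl a b x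
  eval-quotient a (b ∷ bs@(_ ∷ _)) x = begin
    (b + x * eval bs x) + (b + a * eval bs a)
      ≈⟨ solve 5 (λ a b x u v → (b :+ x :* u) :+ (b :+ a :* v) := (x :+ a) :* v :+ x :* (u :+ v))
           refl a b x (eval bs x) (eval bs a) ⟩
    (x + a) * eval bs a + x * (eval bs x + eval bs a)
      ≈⟨ +-congˡ (*-congˡ (eval-quotient a bs x)) ⟩
    (x + a) * eval bs a + x * ((x + a) * eval (quotient a bs) x)
      ≈⟨ solve 4 (λ a x v w → (x :+ a) :* v :+ x :* ((x :+ a) :* w) := (x :+ a) :* (v :+ x :* w))
           refl a x (eval bs a) (eval (quotient a bs) x) ⟩
    (x + a) * (eval bs a + x * eval (quotient a bs) x) ∎

  -- Induction on the degree: dividing by `X + r zero` keeps every other `r (suc i)` a root, since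
  -- `r (suc i) + r zero` is nonzero and cancels. In degree 0 the polynomial is the constant `1#`.
  tooManyRoots : ∀ {d} (p : Monic d) (r : Fin (suc d) → Carrier) → Injective _≡_ _≈_ r →
                 ¬ (∀ i → eval p (r i) ≈ 0#)
  tooManyRoots []         r r-injective root = 1≉0 (root zero)
  tooManyRoots p@(_ ∷ _) r r-injective root =
    tooManyRoots (quotient (r zero) p) (r ∘ suc) (Fin.suc-injective ∘ r-injective) λ i →
      x*y≈0⇒y≈0
        (λ eq → Fin.0≢1+n (≡.sym (r-injective (x+y≈0⇒x≈y eq))))
        (trans (sym (eval-quotient (r zero) p (r (suc i))))
          (trans (+-cong (root (suc i)) (root zero)) (+-identityˡ 0#)))

  monomial : ∀ d → Monic d
  monomial d = replicate d 0#

  eval-monomial : ∀ d x → eval (monomial d) x ≈ x ^ d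
  eval-monomial zero    x = refl
  eval-monomial (suc d) x = trans (+-identityˡ _) (*-congˡ (eval-monomial d x))

-- The field with 2^m elements: characteristic, square roots and Frobenius maps.

module FiniteFieldOfCharacteristicTwo {c ℓ} (L : Field c ℓ) {m} (1≤m : 1 ≤ m)
         (card : HasCardinality (Field.setoid L) (2 ℕ.^ m)) where
  open Field L hiding (zero)
  open FieldProperties L
  open FiniteField L card public
  open Exp commutativeSemiring
  open Mult semiring using (×1-homo-*; ×-homo-1) renaming (_×_ to _·_)
  open ≈-Reasoning setoid

  -- `(2 ℕ.^ m) · 1#` is the `m`-th power of `1# + 1#`, so it could not vanish if `1# + 1#` were
  -- nonzero. Decidable equality removes the double negation.
  1+1≈0 : 1# + 1# ≈ 0#
  1+1≈0 = decidable-stable (1# + 1# ≟ 0#) (λ 2≉0 → 2^n·1≉0 2≉0 m q·1≈0)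
    where
    2^n·1≉0 : 1# + 1# ≉ 0# → ∀ n → (2 ℕ.^ n) · 1# ≉ 0#
    2^n·1≉0 2≉0 zero    eq = 1≉0 (trans (sym (×-homo-1 1#)) eq)
    2^n·1≉0 2≉0 (suc n) eq = x*y≉0
      (2≉0 ∘ trans (+-congˡ (sym (×-homo-1 1#)))) (2^n·1≉0 2≉0 n)
      (trans (sym (×1-homo-* 2 (2 ℕ.^ n))) eq)

  open CharacteristicTwo commutativeRing 1+1≈0 public
  open Solver using (solve; con; _:+_; _:*_; _:=_)
  open MonicPolynomial L 1+1≈0

  infix 25 _²
  _² : Carrier → Carrier
  x ² = x * x

  ²-injective : ∀ {x y} → x ² ≈ y ² → x ≈ y
  ²-injective {x} {y} x²≈y² = decidable-stable (x ≟ y) λ x≉y →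
    let x+y≉0 = x≉y ∘ x+y≈0⇒x≈y in
    x*y≉0 x+y≉0 x+y≉0 (begin
      (x + y) * (x + y)  ≈⟨ solve 2 (λ x y → (x :+ y) :* (x :+ y) := x :* x :+ y :* y) refl x y ⟩
      x ² + y ²          ≈⟨ x≈y⇒x+y≈0 x²≈y² ⟩
      0#                 ∎)

  x^2^[1+s]≈[x²]^2^s : ∀ s x → x ^ (2 ℕ.^ suc s) ≈ (x ²) ^ (2 ℕ.^ s)
  x^2^[1+s]≈[x²]^2^s s x = trans (sym (^-assocʳ x 2 (2 ℕ.^ s)))
    (^-congˡ (2 ℕ.^ s) (*-congˡ (*-identityʳ x)))

  frobenius-+ : ∀ s x y → (x + y) ^ (2 ℕ.^ s) ≈ x ^ (2 ℕ.^ s) + y ^ (2 ℕ.^ s)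
  frobenius-+ zero    x y = distribʳ 1# x y
  frobenius-+ (suc s) x y = begin
    (x + y) ^ (2 ℕ.^ suc s)
      ≈⟨ x^2^[1+s]≈[x²]^2^s s (x + y) ⟩
    ((x + y) ²) ^ (2 ℕ.^ s)
      ≈⟨ ^-congˡ (2 ℕ.^ s) (solve 2 (λ x y → (x :+ y) :* (x :+ y) := x :* x :+ y :* y) refl x y) ⟩
    (x ² + y ²) ^ (2 ℕ.^ s)
      ≈⟨ frobenius-+ s (x ²) (y ²) ⟩
    (x ²) ^ (2 ℕ.^ s) + (y ²) ^ (2 ℕ.^ s)
      ≈⟨ +-cong (x^2^[1+s]≈[x²]^2^s s x) (x^2^[1+s]≈[x²]^2^s s y) ⟨
    x ^ (2 ℕ.^ suc s) + y ^ (2 ℕ.^ suc s) ∎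

  1^n≈1 : ∀ n → 1# ^ n ≈ 1#
  1^n≈1 zero    = refl
  1^n≈1 (suc n) = trans (*-identityˡ _) (1^n≈1 n)

  x^2^m≈x : ∀ x → x ^ (2 ℕ.^ m) ≈ x
  x^2^m≈x = x^q≈x (ℕ.m^n>0 2 m)

  -- Squaring is inverted by its own iterate of order `m - 1`, because its `m`-th iterate is the
  -- identity.
  squareRoot : ∀ x → ∃ λ u → u ² ≈ x
  squareRoot x = x ^ (2 ℕ.^ ℕ.pred m) , (begin
    (x ^ (2 ℕ.^ ℕ.pred m)) ²  ≈⟨ ^-distrib-* x x (2 ℕ.^ ℕ.pred m) ⟨
    (x ²) ^ (2 ℕ.^ ℕ.pred m)  ≈⟨ x^2^[1+s]≈[x²]^2^s (ℕ.pred m) x ⟨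
    x ^ (2 ℕ.^ suc (ℕ.pred m))
      ≡⟨ ≡.cong (λ n → x ^ (2 ℕ.^ n)) (ℕ.suc-pred m {{ℕ.>-nonZero 1≤m}}) ⟩
    x ^ (2 ℕ.^ m)             ≈⟨ x^2^m≈x x ⟩
    x                         ∎)

  private
    -- Otherwise every field element would be a root of `X^d + X`, which is monic of degree `d` as
    -- `2 ≤ d`, and there are more than `d` elements.
    ¬x^d≈x : ∀ {d} → 2 ≤ d → d < 2 ℕ.^ m → ¬ (∀ x → x ^ d ≈ x)
    ¬x^d≈x {suc (suc d)} _ d<q x^d≈x =
      tooManyRoots (0# ∷ 1# ∷ monomial d) (λ i → element (inject≤ i d<q))
        (Fin.inject≤-injective d<q d<q _ _ ∘ element-injective)
        (λ i → let x = element (inject≤ i d<q) in begin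
          0# + x * (1# + x * eval (monomial d) x)
            ≈⟨ +-congˡ (*-congˡ (+-congˡ (*-congˡ (eval-monomial d x)))) ⟩
          0# + x * (1# + x * x ^ d)
            ≈⟨ solve 2 (λ x w → con false :+ x :* (con true :+ x :* w) := x :+ x :* (x :* w)) refl x (x ^ d) ⟩
          x + x ^ suc (suc d)
            ≈⟨ x≈y⇒x+y≈0 (sym (x^d≈x x)) ⟩
          0# ∎)
    ¬x^d≈x {suc zero} (ℕ.s≤s ())

    frobenius≉id-< : ∀ {s} → 0 < s → s < m → ¬ (∀ x → x ^ (2 ℕ.^ s) ≈ x)
    frobenius≉id-< 0<s s<m = ¬x^d≈x (ℕ.^-monoʳ-≤ 2 0<s) (ℕ.^-monoʳ-< 2 ℕ.≤-refl s<m)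

  -- For `s < m` the exponent lies below the field size. For `m < s`, the identity
  -- `x ^ (2 ℕ.^ m) ≈ x` reduces `s` to `s ∸ m`, which is strictly between 0 and `m`.
  frobenius≉id : ∀ {s} → 0 < s → s < 2 ℕ.* m → s ≢ m → ¬ (∀ x → x ^ (2 ℕ.^ s) ≈ x)
  frobenius≉id {s} 0<s s<2m s≢m fixed with ℕ.<-cmp s m
  ... | tri< s<m _ _ = frobenius≉id-< 0<s s<m fixed
  ... | tri≈ _ s≡m _ = s≢m s≡m
  ... | tri> _ _ m<s = frobenius≉id-< (ℕ.m<n⇒0<n∸m m<s) s∸m<m (λ x → begin
      x ^ (2 ℕ.^ (s ℕ.∸ m))                   ≈⟨ ^-congˡ (2 ℕ.^ (s ℕ.∸ m)) (x^2^m≈x x) ⟨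
      (x ^ (2 ℕ.^ m)) ^ (2 ℕ.^ (s ℕ.∸ m))     ≈⟨ ^-assocʳ x (2 ℕ.^ m) (2 ℕ.^ (s ℕ.∸ m)) ⟩
      x ^ (2 ℕ.^ m ℕ.* 2 ℕ.^ (s ℕ.∸ m))       ≡⟨ ≡.cong (x ^_) (ℕ.^-distribˡ-+-* 2 m (s ℕ.∸ m)) ⟨
      x ^ (2 ℕ.^ (m ℕ.+ (s ℕ.∸ m)))           ≡⟨ ≡.cong (λ n → x ^ (2 ℕ.^ n)) (ℕ.m+[n∸m]≡n (ℕ.<⇒≤ m<s)) ⟩
      x ^ (2 ℕ.^ s)                           ≈⟨ fixed x ⟩
      x                                       ∎)
    where
    s∸m<m : s ℕ.∸ m < m
    s∸m<m = ℕ.+-cancelˡ-< m _ _ (≡.subst₂ _<_ (≡.sym (ℕ.m+[n∸m]≡n (ℕ.<⇒≤ m<s)))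
      (≡.cong (m ℕ.+_) (ℕ.+-identityʳ m)) s<2m)

-- The product of B(2,m,s,l,t), and what legitimacy and admissibility provide.

module _ {a} {A : Set a} (add mul : Op₂ A) where
  private
    infixl 6 _⊕_
    infixl 7 _⊗_
    _⊕_ _⊗_ : Op₂ A
    _⊕_ = add
    _⊗_ = mul

  -- The first component of (a , b) ∘ (c , d), with a′ for a ^ σ, etc.; abstracting from the
  -- operations lets it serve both as an element of the field and as a polynomial for the solver.
  firstComponent : (p₁ p₂ p₃ p₄ l a a′ b b′ c c′ d d′ : A) → A
  firstComponent p₁ p₂ p₃ p₄ l a a′ b b′ c c′ d d′ =
      p₁ ⊗ a ⊗ c′ ⊕ l ⊗ p₁ ⊗ a′ ⊗ c
    ⊕ p₂ ⊗ b ⊗ c′ ⊕ l ⊗ p₂ ⊗ a′ ⊗ d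
    ⊕ p₃ ⊗ a ⊗ d′ ⊕ l ⊗ p₃ ⊗ b′ ⊗ c
    ⊕ p₄ ⊗ b ⊗ d′ ⊕ l ⊗ p₄ ⊗ b′ ⊗ d

module Obstruction {c ℓ} (L : Field c ℓ) {m} (1≤m : 1 ≤ m)
         (card : HasCardinality (Field.setoid L) (2 ℕ.^ m))
         {s} (0<s : 0 < s) (s<2m : s < 2 ℕ.* m) (s≢m : s ≢ m)
         (p₁ p₂ p₃ p₄ l : Field.Carrier L) where
  open Field L hiding (zero)
  open FieldProperties L
  open FiniteFieldOfCharacteristicTwo L 1≤m card
  open Solver using (Polynomial; solve; con; _:+_; _:*_; _:=_)
  open Exp commutativeSemiring
  open ≈-Reasoning setoid

  σ : ℕ
  σ = 2 ℕ.^ s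

  1≤σ : 1 ≤ σ
  1≤σ = ℕ.m^n>0 2 s

  infix 4 _≈²_
  _≈²_ : (x y : Carrier × Carrier) → Set ℓ
  _≈²_ = Pointwise _≈_ _≈_

  infixl 7 _∘B_
  _∘B_ : Op₂ (Carrier × Carrier)
  _∘B_ = B-mul L s l (p₁ , p₂ , p₃ , p₄)

  first : (a a′ b b′ c c′ d d′ : Carrier) → Carrier
  first = firstComponent _+_ _*_ p₁ p₂ p₃ p₄ l

  first-cong : ∀ {a₁ a₂ a₁′ a₂′ b₁ b₂ b₁′ b₂′ c₁ c₂ c₁′ c₂′ d₁ d₂ d₁′ d₂′} →
               a₁ ≈ a₂ → a₁′ ≈ a₂′ → b₁ ≈ b₂ → b₁′ ≈ b₂′ →
               c₁ ≈ c₂ → c₁′ ≈ c₂′ → d₁ ≈ d₂ → d₁′ ≈ d₂′ →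
               first a₁ a₁′ b₁ b₁′ c₁ c₁′ d₁ d₁′ ≈ first a₂ a₂′ b₂ b₂′ c₂ c₂′ d₂ d₂′
  first-cong a a′ b b′ c c′ d d′ =
    +-cong (+-cong (+-cong (+-cong (+-cong (+-cong (+-cong
      (*-cong (*-congˡ a) c′) (*-cong (*-congˡ a′) c))
      (*-cong (*-congˡ b) c′)) (*-cong (*-congˡ a′) d))
      (*-cong (*-congˡ a) d′)) (*-cong (*-congˡ b′) c))
      (*-cong (*-congˡ b) d′)) (*-cong (*-congˡ b′) d)

  ∘B-cong : ∀ {x₁ x₂ y₁ y₂} → x₁ ≈² x₂ → y₁ ≈² y₂ → (x₁ ∘B y₁) ≈² (x₂ ∘B y₂)
  ∘B-cong (a , b) (c , d) =
      first-cong a (^-congˡ σ a) b (^-congˡ σ b) c (^-congˡ σ c) d (^-congˡ σ d)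
    , +-cong (*-cong a d) (*-cong b c)

  -- X = p₂ / p₁ is a root of p₁ * (p₁ X^(σ+1) + p₂ X^σ + p₃ X + p₄) = (p₁ X^σ + p₃) (p₁ X + p₂)
  -- when p₁ p₄ = p₂ p₃.
  legitimate⇒det≉0 : Legitimate L s (p₁ , p₂ , p₃ , p₄) → p₁ * p₄ + p₂ * p₃ ≉ 0#
  legitimate⇒det≉0 (p₁≉0 , noRoot) det≈0 = noRoot (x , x*y≈0⇒y≈0 p₁≉0 (begin
    p₁ * (p₁ * x ^ (σ ℕ.+ 1) + p₂ * x ^ σ + p₃ * x + p₄)
      ≈⟨ *-congˡ (+-congʳ (+-congʳ (+-congʳ (*-congˡ (trans (^-homo-* x σ 1) (*-congˡ (*-identityʳ x))))))) ⟩
    p₁ * (p₁ * (x ^ σ * x) + p₂ * x ^ σ + p₃ * x + p₄)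
      ≈⟨ solve 6 (λ p₁ p₂ p₃ p₄ x x′ →
           p₁ :* (p₁ :* (x′ :* x) :+ p₂ :* x′ :+ p₃ :* x :+ p₄) :=
           (p₁ :* x′ :+ p₃) :* (p₁ :* x :+ p₂) :+ (p₁ :* p₄ :+ p₂ :* p₃)) refl p₁ p₂ p₃ p₄ x (x ^ σ) ⟩
    (p₁ * x ^ σ + p₃) * (p₁ * x + p₂) + (p₁ * p₄ + p₂ * p₃)
      ≈⟨ +-cong (*-congˡ (x≈y⇒x+y≈0 p₁x≈p₂)) det≈0 ⟩
    (p₁ * x ^ σ + p₃) * 0# + 0#
      ≈⟨ trans (+-identityʳ _) (zeroʳ _) ⟩
    0# ∎))
    where
    x = proj₁ (inverse p₁≉0) * p₂

    p₁x≈p₂ : p₁ * x ≈ p₂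
    p₁x≈p₂ = trans (sym (*-assoc _ _ _)) (trans (*-congʳ (proj₂ (proj₂ (inverse p₁≉0)))) (*-identityˡ p₂))

  -- Dividing `u ^ σ ≈ l * u` by `u` would exhibit `l` as a `(σ ∸ 1)`-th power of a unit; for
  -- `l ≈ 0#` it would make `u ^ σ` vanish.
  admissible⇒noFixedLine : Admissible L s l → ∀ {u} → u ≉ 0# → u ^ σ ≉ l * u
  admissible⇒noFixedLine (inj₁ l≈0) {u} u≉0 eq =
    x^n≉0 σ u≉0 (trans eq (trans (*-congʳ l≈0) (zeroˡ u)))
  admissible⇒noFixedLine (inj₂ (_ , l∉)) {u} u≉0 eq = l∉ (u , u≉0 , *-cancelˡ u≉0 (begin
    u * l                     ≈⟨ *-comm u l ⟩
    l * u                     ≈⟨ eq ⟨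
    u ^ σ                     ≡⟨ ≡.cong (u ^_) (ℕ.m+[n∸m]≡n 1≤σ) ⟨
    u * u ^ (σ ℕ.∸ 1)         ∎))

  -- The matrix of `T` and the contradiction drawn from its determinant.

  module _ (T : Carrier × Carrier → Carrier × Carrier)
           (T-injective : ∀ {x y} → T x ≈² T y → x ≈² y)
           (T-symmetric : ∀ x y → (x ∘B T y) ≈² (y ∘B T x)) where

    r k n : Carrier
    r = proj₁ (T (1# , 0#))
    k = proj₂ (T (1# , 0#))
    n = proj₁ (T (0# , 1#))

    r′ k′ n′ : Carrier
    r′ = r ^ σ
    k′ = k ^ σ
    n′ = n ^ σ

    -- In the second component `ad + bc`, pairing with `(0# , 1#)` and `(1# , 0#)` reads off the two
    -- coordinates of `T (a , b)`. Pairing these two vectors with each other makes the diagonal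
    -- entries equal.
    T-linear : ∀ a b → T (a , b) ≈² (a * r + b * n , a * k + b * r)
    T-linear a b = T₁ , T₂
      where
      t u v : Carrier
      t = proj₂ (T (0# , 1#))
      u = proj₁ (T (a , b))
      v = proj₂ (T (a , b))

      t≈r : t ≈ r
      t≈r = begin
        t                  ≈⟨ solve 2 (λ t n → t := con true :* t :+ con false :* n) refl t n ⟩
        1# * t + 0# * n    ≈⟨ proj₂ (T-symmetric (1# , 0#) (0# , 1#)) ⟩
        0# * k + 1# * r    ≈⟨ solve 2 (λ k r → con false :* k :+ con true :* r := r) refl k r ⟩
        r                  ∎

      T₁ : u ≈ a * r + b * n
      T₁ = begin
        u                  ≈⟨ solve 2 (λ u v → u := con false :* v :+ con true :* u) refl u v ⟩
        0# * v + 1# * u    ≈⟨ proj₂ (T-symmetric (a , b) (0# , 1#)) ⟨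
        a * t + b * n      ≈⟨ +-congʳ (*-congˡ t≈r) ⟩
        a * r + b * n      ∎

      T₂ : v ≈ a * k + b * r
      T₂ = begin
        v                  ≈⟨ solve 2 (λ u v → v := con true :* v :+ con false :* u) refl u v ⟩
        1# * v + 0# * u    ≈⟨ proj₂ (T-symmetric (a , b) (1# , 0#)) ⟨
        a * k + b * r      ∎

    detT : Carrier
    detT = r * r + n * k

    T-kernel : ∀ {a b} → a * r + b * n ≈ 0# → a * k + b * r ≈ 0# → a ≈ 0# × b ≈ 0#
    T-kernel {a} {b} eq₁ eq₂ = T-injective
      ( trans (proj₁ (T-linear a b)) (trans eq₁ (trans (zeroes r n) (sym (proj₁ (T-linear 0# 0#)))))
      , trans (proj₂ (T-linear a b)) (trans eq₂ (trans (zeroes k r) (sym (proj₂ (T-linear 0# 0#))))))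
      where
      zeroes : ∀ x y → 0# ≈ 0# * x + 0# * y
      zeroes = solve 2 (λ x y → con false := con false :* x :+ con false :* y) refl

    -- `T` sends `(r , k)` to `(detT , 0#)`, so `detT ≈ 0#` forces `r` and `k` to vanish. Then
    -- `(1# , 0#)` lies in the kernel as well.
    detT≉0 : detT ≉ 0#
    detT≉0 detT≈0 = 1≉0 (proj₁ (T-kernel
      (trans (1*x+0*y≈x r n) (proj₁ rk)) (trans (1*x+0*y≈x k r) (proj₂ rk))))
      where
      1*x+0*y≈x : ∀ x y → 1# * x + 0# * y ≈ x
      1*x+0*y≈x = solve 2 (λ x y → con true :* x :+ con false :* y := x) refl

      rk : r ≈ 0# × k ≈ 0#
      rk = T-kernel (trans (+-congˡ (*-comm k n)) detT≈0)
             (solve 2 (λ r k → r :* k :+ k :* r := con false) refl r k)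

    -- Separate names for the `σ`-th powers allow `0# ^ σ` and `1# ^ σ` to be replaced by `0#` and
    -- `1#` before the solver is applied.
    first-symmetric :
      ∀ {a a′ b b′ c c′ d d′} → a ^ σ ≈ a′ → b ^ σ ≈ b′ → c ^ σ ≈ c′ → d ^ σ ≈ d′ →
      first a a′ b b′ (c * r + d * n) (c′ * r′ + d′ * n′) (c * k + d * r) (c′ * k′ + d′ * r′) ≈
      first c c′ d d′ (a * r + b * n) (a′ * r′ + b′ * n′) (a * k + b * r) (a′ * k′ + b′ * r′)
    first-symmetric {a} {a′} {b} {b′} {c} {c′} {d} {d′} a^σ b^σ c^σ d^σ = trans (sym (expand a^σ b^σ c^σ d^σ))
      (trans (proj₁ (T-symmetric (a , b) (c , d))) (expand c^σ d^σ a^σ b^σ))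
      where
      expand : ∀ {a a′ b b′ c c′ d d′} → a ^ σ ≈ a′ → b ^ σ ≈ b′ → c ^ σ ≈ c′ → d ^ σ ≈ d′ →
        proj₁ ((a , b) ∘B T (c , d)) ≈
        first a a′ b b′ (c * r + d * n) (c′ * r′ + d′ * n′) (c * k + d * r) (c′ * k′ + d′ * r′)
      expand {c = c} {d = d} a^σ b^σ c^σ d^σ = first-cong refl a^σ refl b^σ
        (proj₁ (T-linear c d)) (power (proj₁ (T-linear c d)))
        (proj₂ (T-linear c d)) (power (proj₂ (T-linear c d)))
        where
        power : ∀ {x y z} → x ≈ c * y + d * z → x ^ σ ≈ _ * y ^ σ + _ * z ^ σ
        power {x} {y} {z} eq = trans (^-congˡ σ eq) (trans (frobenius-+ s _ _)
          (+-cong (trans (^-distrib-* _ _ σ) (*-congʳ c^σ)) (trans (^-distrib-* _ _ σ) (*-congʳ d^σ))))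

    0^σ : 0# ^ σ ≈ 0#
    0^σ = 0^n≈0 1≤σ

    1^σ : 1# ^ σ ≈ 1#
    1^σ = 1^n≈1 σ

    -- An element not fixed by the Frobenius map `_^ σ`; it separates the coefficients of `d ^ σ`
    -- from those of `d`.
    θ : Carrier
    θ = proj₁ (∃-counterexample (_^ σ) (^-congˡ σ) (frobenius≉id 0<s s<2m s≢m))

    θ^σ+θ≉0 : θ ^ σ + θ ≉ 0#
    θ^σ+θ≉0 = proj₂ (∃-counterexample (_^ σ) (^-congˡ σ) (frobenius≉id 0<s s<2m s≢m)) ∘ x+y≈0⇒x≈y

    private
      firstₚ : ∀ {j} (p₁ p₂ p₃ p₄ l a a′ b b′ c c′ d d′ : Polynomial j) → Polynomial j
      firstₚ = firstComponent _:+_ _:*_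

      0ₚ 1ₚ : ∀ {j} → Polynomial j
      0ₚ = con false
      1ₚ = con true

    -- The symmetry at `(1# , 0#)` and `(θ , 0#)` is this entry of the matrix identity multiplied by
    -- `θ ^ σ + θ`. The entry `eq₂₂` arises in the same way from `(0# , 1#)` and `(0# , θ)`.
    eq₁₁ : p₁ * r′ + p₃ * k′ ≈ l * (p₁ * r + p₂ * k)
    eq₁₁ = x+y≈0⇒x≈y (x*y≈0⇒y≈0 θ^σ+θ≉0 (trans
      (solve 13 (λ p₁ p₂ p₃ p₄ l r n k r′ n′ k′ c c′ →
        (c′ :+ c) :* (p₁ :* r′ :+ p₃ :* k′ :+ l :* (p₁ :* r :+ p₂ :* k)) :=
        firstₚ p₁ p₂ p₃ p₄ l 1ₚ 1ₚ 0ₚ 0ₚ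
          (c :* r :+ 0ₚ :* n) (c′ :* r′ :+ 0ₚ :* n′) (c :* k :+ 0ₚ :* r) (c′ :* k′ :+ 0ₚ :* r′) :+
        firstₚ p₁ p₂ p₃ p₄ l c c′ 0ₚ 0ₚ
          (1ₚ :* r :+ 0ₚ :* n) (1ₚ :* r′ :+ 0ₚ :* n′) (1ₚ :* k :+ 0ₚ :* r) (1ₚ :* k′ :+ 0ₚ :* r′))
        refl p₁ p₂ p₃ p₄ l r n k r′ n′ k′ θ (θ ^ σ))
      (x≈y⇒x+y≈0 (first-symmetric 1^σ 0^σ refl 0^σ))))

    eq₂₂ : p₂ * n′ + p₄ * r′ ≈ l * (p₃ * n + p₄ * r)
    eq₂₂ = x+y≈0⇒x≈y (x*y≈0⇒y≈0 θ^σ+θ≉0 (trans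
      (solve 13 (λ p₁ p₂ p₃ p₄ l r n k r′ n′ k′ d d′ →
        (d′ :+ d) :* (p₂ :* n′ :+ p₄ :* r′ :+ l :* (p₃ :* n :+ p₄ :* r)) :=
        firstₚ p₁ p₂ p₃ p₄ l 0ₚ 0ₚ 1ₚ 1ₚ
          (0ₚ :* r :+ d :* n) (0ₚ :* r′ :+ d′ :* n′) (0ₚ :* k :+ d :* r) (0ₚ :* k′ :+ d′ :* r′) :+
        firstₚ p₁ p₂ p₃ p₄ l 0ₚ 0ₚ d d′
          (0ₚ :* r :+ 1ₚ :* n) (0ₚ :* r′ :+ 1ₚ :* n′) (0ₚ :* k :+ 1ₚ :* r) (0ₚ :* k′ :+ 1ₚ :* r′))
        refl p₁ p₂ p₃ p₄ l r n k r′ n′ k′ θ (θ ^ σ))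
      (x≈y⇒x+y≈0 (first-symmetric 0^σ 1^σ 0^σ refl))))

    private
      U V : Carrier
      U = p₁ * n′ + p₃ * r′ + l * (p₃ * r + p₄ * k)
      V = p₂ * r′ + p₄ * k′ + l * (p₁ * n + p₂ * r)

      -- The symmetry at `(1# , 0#)` and `(0# , d)` couples the defects `U` and `V` of the two
      -- off-diagonal entries. Taking `d` to be `1#` makes them equal, and `θ` then makes both
      -- vanish.
      mixed : ∀ {d d′} → d ^ σ ≈ d′ → U * d′ + V * d ≈ 0#
      mixed {d} {d′} d^σ = trans
        (solve 13 (λ p₁ p₂ p₃ p₄ l r n k r′ n′ k′ d d′ →
          (p₁ :* n′ :+ p₃ :* r′ :+ l :* (p₃ :* r :+ p₄ :* k)) :* d′ :+
          (p₂ :* r′ :+ p₄ :* k′ :+ l :* (p₁ :* n :+ p₂ :* r)) :* d :=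
          firstₚ p₁ p₂ p₃ p₄ l 1ₚ 1ₚ 0ₚ 0ₚ
            (0ₚ :* r :+ d :* n) (0ₚ :* r′ :+ d′ :* n′) (0ₚ :* k :+ d :* r) (0ₚ :* k′ :+ d′ :* r′) :+
          firstₚ p₁ p₂ p₃ p₄ l 0ₚ 0ₚ d d′
            (1ₚ :* r :+ 0ₚ :* n) (1ₚ :* r′ :+ 0ₚ :* n′) (1ₚ :* k :+ 0ₚ :* r) (1ₚ :* k′ :+ 0ₚ :* r′))
          refl p₁ p₂ p₃ p₄ l r n k r′ n′ k′ d d′)
        (x≈y⇒x+y≈0 (first-symmetric 1^σ 0^σ 0^σ d^σ))

      U≈V : U ≈ V
      U≈V = x+y≈0⇒x≈y (trans (sym (+-cong (*-identityʳ U) (*-identityʳ V))) (mixed 1^σ))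

      U≈0 : U ≈ 0#
      U≈0 = x*y≈0⇒y≈0 θ^σ+θ≉0 (begin
        (θ ^ σ + θ) * U    ≈⟨ *-comm _ U ⟩
        U * (θ ^ σ + θ)    ≈⟨ distribˡ U _ _ ⟩
        U * θ ^ σ + U * θ  ≈⟨ +-congˡ (*-congʳ U≈V) ⟩
        U * θ ^ σ + V * θ  ≈⟨ mixed refl ⟩
        0#                 ∎)

    eq₁₂ : p₁ * n′ + p₃ * r′ ≈ l * (p₃ * r + p₄ * k)
    eq₁₂ = x+y≈0⇒x≈y U≈0

    eq₂₁ : p₂ * r′ + p₄ * k′ ≈ l * (p₁ * n + p₂ * r)
    eq₂₁ = x+y≈0⇒x≈y (trans (sym U≈V) U≈0)

    -- Both sides of the matrix identity have determinants divisible by `p₁ * p₄ + p₂ * p₃`, which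
    -- cancels. The scalar `l` contributes its square because the matrices are 2 by 2.
    detT^σ≈l²*detT : p₁ * p₄ + p₂ * p₃ ≉ 0# → detT ^ σ ≈ l ² * detT
    detT^σ≈l²*detT det≉0 = *-cancelˡ det≉0 (begin
      (p₁ * p₄ + p₂ * p₃) * detT ^ σ
        ≈⟨ *-congˡ (trans (frobenius-+ s _ _) (+-cong (^-distrib-* r r σ) (^-distrib-* n k σ))) ⟩
      (p₁ * p₄ + p₂ * p₃) * (r′ * r′ + n′ * k′)
        ≈⟨ solve 7 (λ p₁ p₂ p₃ p₄ r n k →
             (p₁ :* p₄ :+ p₂ :* p₃) :* (r :* r :+ n :* k) :=
             (p₁ :* r :+ p₃ :* k) :* (p₂ :* n :+ p₄ :* r) :+ (p₁ :* n :+ p₃ :* r) :* (p₂ :* r :+ p₄ :* k))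
             refl p₁ p₂ p₃ p₄ r′ n′ k′ ⟩
      (p₁ * r′ + p₃ * k′) * (p₂ * n′ + p₄ * r′) + (p₁ * n′ + p₃ * r′) * (p₂ * r′ + p₄ * k′)
        ≈⟨ +-cong (*-cong eq₁₁ eq₂₂) (*-cong eq₁₂ eq₂₁) ⟩
      (l * (p₁ * r + p₂ * k)) * (l * (p₃ * n + p₄ * r)) + (l * (p₃ * r + p₄ * k)) * (l * (p₁ * n + p₂ * r))
        ≈⟨ solve 8 (λ p₁ p₂ p₃ p₄ l r n k →
             (l :* (p₁ :* r :+ p₂ :* k)) :* (l :* (p₃ :* n :+ p₄ :* r)) :+
             (l :* (p₃ :* r :+ p₄ :* k)) :* (l :* (p₁ :* n :+ p₂ :* r)) :=
             (p₁ :* p₄ :+ p₂ :* p₃) :* ((l :* l) :* (r :* r :+ n :* k)))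
             refl p₁ p₂ p₃ p₄ l r n k ⟩
      (p₁ * p₄ + p₂ * p₃) * (l ² * detT) ∎)

    contradiction : Legitimate L s (p₁ , p₂ , p₃ , p₄) → Admissible L s l → ⊥
    contradiction legitimate admissible =
      let (u , u²≈detT) = squareRoot detT in
      admissible⇒noFixedLine admissible
        (λ u≈0 → detT≉0 (trans (sym u²≈detT) (trans (*-congʳ u≈0) (zeroˡ u))))
        (²-injective (begin
          (u ^ σ) ²    ≈⟨ ^-distrib-* u u σ ⟨
          (u ²) ^ σ    ≈⟨ ^-congˡ σ u²≈detT ⟩
          detT ^ σ     ≈⟨ detT^σ≈l²*detT (legitimate⇒det≉0 legitimate) ⟩
          l ² * detT   ≈⟨ *-congˡ u²≈detT ⟨
          l ² * u ²    ≈⟨ solve 2 (λ l u → (l :* l) :* (u :* u) := (l :* u) :* (l :* u)) refl l u ⟩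
          (l * u) ²    ∎))

-- From an isotopism to the map `T`.

open import Data.Nat.Base using (_*_; _^_)

theorem7 : ∀ {c ℓ c′ ℓ′} (m s : ℕ) → 1 ≤ m → 0 < s → s < 2 * m → s ≢ m →
    (L : Field c ℓ) → HasCardinality (Field.setoid L) (2 ^ m) →
    (t : Quadruple L) → Legitimate L s t →
    (l : Field.Carrier L) → Admissible L s l →
    (F : CommutativeSemifield c′ ℓ′) →
    ¬ Isotopic (B L s l t) (CommutativeSemifield.rawNearSemiring F)
theorem7 m s 1≤m 0<s s<2m s≢m L card (p₁ , p₂ , p₃ , p₄) legitimate l admissible F isotopic =
  contradiction T T-injective T-symmetric legitimate admissible
  where
  open Obstruction L 1≤m card 0<s s<2m s≢m p₁ p₂ p₃ p₄ l
  module F = CommutativeSemifield F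
  module F≈ = Setoid F.setoid
  open Isotopic isotopic
  module α₁ = MagmaMorphisms.IsMagmaIsomorphism α₁-iso
  module α₂ = MagmaMorphisms.IsMagmaIsomorphism α₂-iso
  module β = MagmaMorphisms.IsMagmaIsomorphism β-iso
  open Setoid (×-setoid (Field.setoid L) (Field.setoid L))
    using () renaming (refl to refl²; sym to sym²; trans to trans²)

  α₁⁻¹ : _ → _
  α₁⁻¹ x = proj₁ (α₁.surjective x)
  T : _ → _
  T x = α₂ (α₁⁻¹ x)

  α₁-α₁⁻¹ : ∀ x → α₁ (α₁⁻¹ x) ≈² x
  α₁-α₁⁻¹ x = proj₂ (α₁.surjective x) F≈.refl

  T-injective : ∀ {x y} → T x ≈² T y → x ≈² y
  T-injective {x} {y} eq = trans² (sym² (α₁-α₁⁻¹ x))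
    (trans² (α₁.⟦⟧-cong (α₂.injective eq)) (α₁-α₁⁻¹ y))

  -- Under `β` the two sides become `x` times `y` and `y` times `x` in `F`, so commutativity of `F`
  -- and injectivity of `β` suffice.
  α-symmetric : ∀ x y → (α₁ x ∘B α₂ y) ≈² (α₁ y ∘B α₂ x)
  α-symmetric x y = β.injective (F≈.trans (isotopism x y) (F≈.trans (F.*-comm x y) (F≈.sym (isotopism y x))))

  T-symmetric : ∀ x y → (x ∘B T y) ≈² (y ∘B T x)
  T-symmetric x y = trans² (∘B-cong (sym² (α₁-α₁⁻¹ x)) refl²)
    (trans² (α-symmetric (α₁⁻¹ x) (α₁⁻¹ y)) (∘B-cong (α₁-α₁⁻¹ y) refl²))
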